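{- Almost all partitions of $[n]$ contain a singleton block; that is, the proportion of partitions of $[n]$ having at least one block of size $1$, among all partitions of $[n]$, tends to $1$ as $n\to\infty$.
   Context: $[n]=\{1,2,\dots,n\}$; partitions are set partitions into nonempty disjoint blocks. -}

module Defs where

open import Data.Fin.Base using (Fin; zero)
open import Data.Fin.Properties using (all?)
open import Data.Fin.Subset using (Subset; inside; outside; ⊤; _∈_; _∩_; ∣_∣; Nonempty; Empty)
open import Data.Fin.Subset.Properties using (_∈?_; nonempty?; ∈⊤)
open import Data.Integer.Base using (+_)
open import Data.List.Base using (List; []; _∷_; _++_; [_]; map; filter; length)
open import Data.List.Membership.Propositional using () renaming (_∈_ to _∈ˡ_)
open import Data.List.Membership.Propositional.Properties using (∈-++⁺ˡ; ∈-++⁺ʳ; ∈-map⁺; ∈-filter⁺; ∈-length)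
open import Data.List.Relation.Unary.All as All using (All; []; _∷_)
open import Data.List.Relation.Unary.AllPairs as AllPairs using (AllPairs; []; _∷_)
open import Data.List.Relation.Unary.Any as Any using (Any; here; there)
open import Data.Nat.Base as ℕ using (ℕ; zero; suc; NonZero; >-nonZero)
open import Data.Nat.Properties using (_≟_)
open import Data.Product.Base using (∃; _,_)
open import Data.Rational.Base using (ℚ; 0ℚ; _/_; _-_; _<_) renaming (∣_∣ to ∣_∣ℚ)
open import Data.Vec.Base using ([]; _∷_)
open import Level using (Level)
open import Relation.Binary.PropositionalEquality using (_≡_; refl)
open import Relation.Nullary.Decidable using (Dec; map′; _×-dec_; ¬?)

private
  variable
    a : Level
    A : Set a
    n : ℕ

-- Blocks are subsets of Fin n, which stands for [n].

record IsPartition (blocks : List (Subset n)) : Set where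
  field
    nonempty : All Nonempty blocks
    disjoint : AllPairs (λ p q → Empty (p ∩ q)) blocks
    covering : ∀ (i : Fin n) → Any (i ∈_) blocks

HasSingleton : List (Subset n) → Set
HasSingleton = Any (λ p → ∣ p ∣ ≡ 1)

isPartition? : (blocks : List (Subset n)) → Dec (IsPartition blocks)
isPartition? blocks = map′
  (λ (ne , dj , cv) → record { nonempty = ne ; disjoint = dj ; covering = cv })
  (λ π → let open IsPartition π in nonempty , disjoint , covering)
  (All.all? nonempty? blocks
    ×-dec AllPairs.allPairs? (λ p q → ¬? (nonempty? (p ∩ q))) blocks
    ×-dec all? (λ i → Any.any? (i ∈?_) blocks))

hasSingleton? : (blocks : List (Subset n)) → Dec (HasSingleton blocks)
hasSingleton? = Any.any? (λ p → ∣ p ∣ ≟ 1)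

subsets : ∀ n → List (Subset n)
subsets zero    = [ [] ]
subsets (suc n) = map (outside ∷_) (subsets n) ++ map (inside ∷_) (subsets n)

sublists : List A → List (List A)
sublists []       = [ [] ]
sublists (x ∷ xs) = sublists xs ++ map (x ∷_) (sublists xs)

-- A set of blocks is represented by the list of its members in the order in
-- which they occur in `subsets n`.  As `subsets n` lists every subset exactly
-- once, `sublists (subsets n)` lists every set of subsets exactly once, and
-- hence `partitions n` lists every set partition exactly once.

partitions : ∀ n → List (List (Subset n))
partitions n = filter isPartition? (sublists (subsets n))

#partitions : ℕ → ℕ
#partitions n = length (partitions n)

#partitionsWithSingleton : ℕ → ℕ
#partitionsWithSingleton n = length (filter hasSingleton? (partitions n))

[]∈sublists : (xs : List A) → [] ∈ˡ sublists xs
[]∈sublists []       = here refl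
[]∈sublists (x ∷ xs) = ∈-++⁺ˡ ([]∈sublists xs)

[x]∈sublists : ∀ {x : A} {xs} → x ∈ˡ xs → [ x ] ∈ˡ sublists xs
[x]∈sublists {xs = y ∷ ys} (here refl)  = ∈-++⁺ʳ (sublists ys) (∈-map⁺ (y ∷_) ([]∈sublists ys))
[x]∈sublists {xs = y ∷ ys} (there x∈ys) = ∈-++⁺ˡ ([x]∈sublists x∈ys)

⊤∈subsets : ∀ n → ⊤ ∈ˡ subsets n
⊤∈subsets zero    = here refl
⊤∈subsets (suc n) = ∈-++⁺ʳ (map (outside ∷_) (subsets n)) (∈-map⁺ (inside ∷_) (⊤∈subsets n))

#partitions-nonZero : ∀ n → NonZero (#partitions n)
#partitions-nonZero zero    = _
#partitions-nonZero (suc n) = >-nonZero (∈-length (∈-filter⁺ isPartition?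
  ([x]∈sublists (⊤∈subsets (suc n)))
  (record
    { nonempty = (zero , ∈⊤) ∷ []
    ; disjoint = [] ∷ []
    ; covering = λ _ → here ∈⊤
    })))

proportionWithSingleton : ℕ → ℚ
proportionWithSingleton n = (+ #partitionsWithSingleton n / #partitions n) {{#partitions-nonZero n}}

infix 4 _⟶_

_⟶_ : (ℕ → ℚ) → ℚ → Set
f ⟶ l = ∀ ε → 0ℚ < ε → ∃ λ N → ∀ n → N ℕ.≤ n → ∣ f n - l ∣ℚ < ε

{-# OPTIONS --safe #-}

-- Let π be a partition of [n] without singletons.  Dissolving one block of π
-- into singletons is reversible, since the singletons of the result are exactly
-- the elements of that block; so the partitions with at least k blocks and no
-- singleton number at most a 1/k fraction of all partitions.  If π has fewer
-- than k blocks, isolate instead one of the n elements x: the result has at most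
-- k blocks, and x and π can be recovered once two of these are pointed out,
-- namely {x} and the rest of the former block of x.  So there are at most k²/n
-- times as many such π as partitions.  Now let n ≥ k³ and k → ∞.

module Submission where

open import Defs
open import Data.Bool.Base using (if_then_else_)
open import Data.Bool.Properties using () renaming (_≟_ to _≟ᵇ_)
open import Data.Fin.Base using (Fin)
open import Data.Fin.Properties using () renaming (_≟_ to _≟ᶠ_)
open import Data.Fin.Subset using (Subset; inside; outside; ⊥; ⁅_⁆; _∈_; _∉_; _⊆_; _∩_; _─_; _-_; ∣_∣; Nonempty; Empty)
open import Data.Fin.Subset.Properties using (_∈?_; nonempty?; ⊆-antisym; x∈⁅x⁆; x∈⁅y⁆⇒x≡y; ∣⁅x⁆∣≡1; x∈p∩q⁺; x∈p∩q⁻; p─q⊆p; x∈p∧x≢y⇒x∈p-y)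
open import Data.Integer.Base as ℤ using (+[1+_]; +<+)
import Data.Integer.Properties as ℤ
open import Data.Integer.Tactic.RingSolver using () renaming (solve-∀ to ℤ-solve-∀)
open import Data.List.Base using (List; []; _∷_; _++_; map; filter; length; concatMap; allFin; cartesianProduct)
open import Data.List.Membership.DecPropositional using () renaming (_∈?_ to member?)
open import Data.List.Membership.Propositional using (lose; find) renaming (_∈_ to _∈ˡ_; _∉_ to _∉ˡ_)
open import Data.List.Membership.Propositional.Properties using (∈-++⁺ˡ; ∈-++⁺ʳ; ∈-++⁻; ∈-map⁺; ∈-map⁻; ∈-filter⁺; ∈-filter⁻; ∈-map∘filter⁺; ∈-map∘filter⁻; ∈-concatMap⁺; ∈-concatMap⁻; ∈-∃++; ∈-allFin; ∈-cartesianProduct⁺)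
open import Data.List.Properties using (length-map; length-++; length-++-sucʳ; length-tabulate; length-filter)
open import Data.List.Relation.Binary.Subset.Propositional using () renaming (_⊆_ to _⊆ˡ_)
open import Data.List.Relation.Unary.All as All using (All; []; _∷_)
import Data.List.Relation.Unary.All.Properties as All
open import Data.List.Relation.Unary.AllPairs using (AllPairs; []; _∷_)
import Data.List.Relation.Unary.AllPairs.Properties as AllPairs
open import Data.List.Relation.Unary.Any using (Any; here; there)
open import Data.List.Relation.Unary.Unique.Propositional using (Unique)
import Data.List.Relation.Unary.Unique.Propositional.Properties as Unique
open import Data.Nat.Base using (ℕ; zero; suc; NonZero; _+_; _*_; _≤_; _<_; z≤n; s≤s)
open import Data.Nat.Properties
open import Data.Nat.Tactic.RingSolver using (solve-∀)
open import Data.Product.Base using (_×_; _,_; proj₁; proj₂; ∃)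
open import Data.Rational.Base using (mkℚ; 0ℚ; 1ℚ; _/_; toℚᵘ; ↧ₙ_; *<*) renaming (_-_ to _-ℚ_; -_ to -ℚ_; ∣_∣ to ∣_∣ℚ; _<_ to _<ℚ_)
import Data.Rational.Properties as ℚ
open import Data.Rational.Unnormalised.Base as ℚᵘ using (mkℚᵘ; _≃_)
import Data.Rational.Unnormalised.Properties as ℚᵘ
open import Data.Sum.Base using (inj₁; inj₂)
open import Data.Vec.Base using ([]; _∷_; here; there)
open import Data.Vec.Properties using (∷-injectiveʳ; ≡-dec)
open import Function.Base using (_∘_)
open import Level using (Level)
open import Relation.Binary.Core using (Rel)
open import Relation.Binary.Definitions using (DecidableEquality)
open import Relation.Binary.PropositionalEquality using (_≡_; _≢_; refl; sym; trans; cong; cong₂; subst; subst₂)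
open import Relation.Nullary.Decidable using (yes; no; ¬?; does)
open import Relation.Nullary.Negation using (¬_; contradiction)
open import Relation.Unary using (Pred; Decidable)

private
  variable
    a b p ℓ : Level
    A : Set a
    B : Set b
    m n : ℕ

-- Counting in lists

length-filter-¬ : {P : Pred A p} (P? : Decidable P) (xs : List A) →
  length (filter P? xs) + length (filter (¬? ∘ P?) xs) ≡ length xs
length-filter-¬ P? []       = refl
length-filter-¬ P? (x ∷ xs) with P? x
... | yes _ = cong suc (length-filter-¬ P? xs)
... | no  _ = trans (+-suc _ _) (cong suc (length-filter-¬ P? xs))

Unique⇒AllPairs : {R : Rel A ℓ} {xs : List A} → Unique xs →
  (∀ {x y} → x ∈ˡ xs → y ∈ˡ xs → x ≢ y → R x y) → AllPairs R xs
Unique⇒AllPairs []         r = []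
Unique⇒AllPairs (x≢ ∷ xs!) r =
  All.tabulate (λ y∈ → r (here refl) (there y∈) (All.lookup x≢ y∈))
  ∷ Unique⇒AllPairs xs! (λ x∈ y∈ → r (there x∈) (there y∈))

Unique-map : (f : A → B) {xs : List A} → Unique xs →
  (∀ {x y} → x ∈ˡ xs → y ∈ˡ xs → f x ≡ f y → x ≡ y) → Unique (map f xs)
Unique-map f xs! inj = AllPairs.map⁺ (Unique⇒AllPairs xs! λ x∈ y∈ x≢y eq → x≢y (inj x∈ y∈ eq))

-- Pigeonhole by deletion: one occurrence of the head is cut out of `ys`, and the tail still lies in
-- what remains because the head does not recur in it.
Unique-⊆⇒length-≤ : {xs ys : List A} → Unique xs → xs ⊆ˡ ys → length xs ≤ length ys
Unique-⊆⇒length-≤                     []         xs⊆ys = z≤n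
Unique-⊆⇒length-≤ {xs = x ∷ xs} (x≢ ∷ xs!) xs⊆ys
  with us , vs , refl ← ∈-∃++ (xs⊆ys (here refl)) =
  ≤-trans (s≤s (Unique-⊆⇒length-≤ xs! xs⊆us++vs)) (≤-reflexive (sym (length-++-sucʳ us x vs)))
  where
  xs⊆us++vs : xs ⊆ˡ us ++ vs
  xs⊆us++vs y∈xs with ∈-++⁻ us (xs⊆ys (there y∈xs))
  ... | inj₁ y∈us         = ∈-++⁺ˡ y∈us
  ... | inj₂ (here refl)  = contradiction refl (All.lookup x≢ y∈xs)
  ... | inj₂ (there y∈vs) = ∈-++⁺ʳ us y∈vs

length-concatMap-≥ : (f : A → List B) (xs : List A) →
  (∀ {x} → x ∈ˡ xs → m ≤ length (f x)) → length xs * m ≤ length (concatMap f xs)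
length-concatMap-≥ f []       m≤ = z≤n
length-concatMap-≥ f (x ∷ xs) m≤ = ≤-trans
  (+-mono-≤ (m≤ (here refl)) (length-concatMap-≥ f xs (m≤ ∘ there)))
  (≤-reflexive (sym (length-++ (f x))))

length-concatMap-≤ : (f : A → List B) (xs : List A) →
  (∀ {x} → x ∈ˡ xs → length (f x) ≤ m) → length (concatMap f xs) ≤ length xs * m
length-concatMap-≤ f []       ≤m = z≤n
length-concatMap-≤ f (x ∷ xs) ≤m = ≤-trans
  (≤-reflexive (length-++ (f x)))
  (+-mono-≤ (≤m (here refl)) (length-concatMap-≤ f xs (≤m ∘ there)))

length-cartesianProduct : (xs : List A) (ys : List B) →
  length (cartesianProduct xs ys) ≡ length xs * length ys
length-cartesianProduct []       ys = refl
length-cartesianProduct (x ∷ xs) ys = trans (length-++ (map (x ,_) ys))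
  (trans (cong (_+ length (cartesianProduct xs ys)) (length-map (x ,_) ys))
         (cong (length ys +_) (length-cartesianProduct xs ys)))

-- The counting principle behind both bounds. The lists `f x` are duplicate-free and pairwise
-- disjoint, so their concatenation is duplicate-free and fits into `ys`. In the applications `f π`
-- lists every outcome of one operation on `π`.
disjoint-images⇒length-≤ : (f : A → List B) {xs : List A} {ys : List B} →
  Unique xs →
  (∀ {x} → x ∈ˡ xs → Unique (f x)) →
  (∀ {x y z} → x ∈ˡ xs → y ∈ˡ xs → z ∈ˡ f x → z ∈ˡ f y → x ≡ y) →
  (∀ {x} → x ∈ˡ xs → f x ⊆ˡ ys) →
  (∀ {x} → x ∈ˡ xs → m ≤ length (f x)) →
  length xs * m ≤ length ys
disjoint-images⇒length-≤ f {xs} xs! f! disj f⊆ys m≤ = ≤-trans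
  (length-concatMap-≥ f xs m≤)
  (Unique-⊆⇒length-≤
    (Unique.concat⁺ (All.map⁺ (All.tabulate f!))
      (AllPairs.map⁺ (Unique⇒AllPairs xs! λ x∈ y∈ x≢y (z∈fx , z∈fy) → x≢y (disj x∈ y∈ z∈fx z∈fy))))
    λ z∈ → let x , x∈xs , z∈fx = find (∈-concatMap⁻ f {xs = xs} z∈) in f⊆ys x∈xs z∈fx)

-- Sublists

∈-sublists⇒⊆ : {xs ys : List A} → xs ∈ˡ sublists ys → xs ⊆ˡ ys
∈-sublists⇒⊆ {ys = []}     (here refl) = λ ()
∈-sublists⇒⊆ {ys = y ∷ ys} xs∈ with ∈-++⁻ (sublists ys) xs∈
... | inj₁ xs∈′ = there ∘ ∈-sublists⇒⊆ {ys = ys} xs∈′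
... | inj₂ xs∈′ with zs , zs∈ , refl ← ∈-map⁻ (y ∷_) xs∈′ =
  λ { (here z≡y) → here z≡y ; (there z∈zs) → there (∈-sublists⇒⊆ zs∈ z∈zs) }

filter∈sublists : {P : Pred A p} (P? : Decidable P) (xs : List A) → filter P? xs ∈ˡ sublists xs
filter∈sublists P? []       = here refl
filter∈sublists P? (x ∷ xs) with P? x
... | yes _ = ∈-++⁺ʳ (sublists xs) (∈-map⁺ (x ∷_) (filter∈sublists P? xs))
... | no  _ = ∈-++⁺ˡ (filter∈sublists P? xs)

sublists-unique : {xs : List A} → Unique xs → Unique (sublists xs)
sublists-unique []                 = [] ∷ []
sublists-unique {xs = x ∷ xs} (x≢ ∷ xs!) = Unique.++⁺ (sublists-unique xs!)
  (Unique.map⁺ (λ { refl → refl }) (sublists-unique xs!))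
  λ (ys∈ , ys∈′) → case-∈ ys∈ (∈-map⁻ (x ∷_) ys∈′)
  where
  case-∈ : ∀ {ys} → ys ∈ˡ sublists xs → ¬ ∃ λ zs → zs ∈ˡ sublists xs × ys ≡ x ∷ zs
  case-∈ ys∈ (_ , _ , refl) = All.lookup x≢ (∈-sublists⇒⊆ ys∈ (here refl)) refl

-- A sublist inherits its order from `zs`, so its members determine it. This reduces equality of
-- partitions to mutual inclusion of their blocks.
sublists-antisym : {xs ys zs : List A} → Unique zs → xs ∈ˡ sublists zs → ys ∈ˡ sublists zs →
  xs ⊆ˡ ys → ys ⊆ˡ xs → xs ≡ ys
sublists-antisym {zs = []}     []         (here refl) (here refl) _ _ = refl
sublists-antisym {zs = z ∷ zs} (z≢ ∷ zs!) xs∈ ys∈ xs⊆ys ys⊆xs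
  with ∈-++⁻ (sublists zs) xs∈ | ∈-++⁻ (sublists zs) ys∈
... | inj₁ xs∈ | inj₁ ys∈ = sublists-antisym zs! xs∈ ys∈ xs⊆ys ys⊆xs
... | inj₁ xs∈ | inj₂ ys∈ with us , us∈ , refl ← ∈-map⁻ (z ∷_) ys∈ =
  contradiction refl (All.lookup z≢ (∈-sublists⇒⊆ xs∈ (ys⊆xs (here refl))))
... | inj₂ xs∈ | inj₁ ys∈ with us , us∈ , refl ← ∈-map⁻ (z ∷_) xs∈ =
  contradiction refl (All.lookup z≢ (∈-sublists⇒⊆ ys∈ (xs⊆ys (here refl))))
... | inj₂ xs∈ | inj₂ ys∈
  with us , us∈ , refl ← ∈-map⁻ (z ∷_) xs∈ | vs , vs∈ , refl ← ∈-map⁻ (z ∷_) ys∈ =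
  cong (z ∷_) (sublists-antisym zs! us∈ vs∈ (tails us∈ xs⊆ys) (tails vs∈ ys⊆xs))
  where
  tails : ∀ {us vs} → us ∈ˡ sublists zs → z ∷ us ⊆ˡ z ∷ vs → us ⊆ˡ vs
  tails us∈ zus⊆zvs u∈us with zus⊆zvs (there u∈us)
  ... | here refl  = contradiction refl (All.lookup z≢ (∈-sublists⇒⊆ us∈ u∈us))
  ... | there u∈vs = u∈vs

-- Finite subsets

_≟ˢ_ : DecidableEquality (Subset n)
_≟ˢ_ = ≡-dec _≟ᵇ_

x∈p─q⇒x∉q : ∀ {x} (p q : Subset n) → x ∈ p ─ q → x ∉ q
x∈p─q⇒x∉q (_ ∷ p) (inside  ∷ q) (there x∈) (there x∈q) = x∈p─q⇒x∉q p q x∈ x∈q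
x∈p─q⇒x∉q (_ ∷ p) (outside ∷ q) (there x∈) (there x∈q) = x∈p─q⇒x∉q p q x∈ x∈q

x∉p-x : ∀ {x} (p : Subset n) → x ∉ p - x
x∉p-x {x = x} p x∈ = x∈p─q⇒x∉q p ⁅ x ⁆ x∈ (x∈⁅x⁆ x)

x∉p⇒p-x≡p : ∀ {x} {p : Subset n} → x ∉ p → p - x ≡ p
x∉p⇒p-x≡p {p = p} x∉p = ⊆-antisym (p─q⊆p p _)
  λ i∈p → x∈p∧x≢y⇒x∈p-y i∈p λ { refl → x∉p i∈p }

remove-injective : ∀ {x} {p q : Subset n} → x ∈ p → x ∈ q → p - x ≡ q - x → p ≡ q
remove-injective {x = x} {p} {q} x∈p x∈q eq = ⊆-antisym (incl p q x∈q eq) (incl q p x∈p (sym eq))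
  where
  incl : ∀ p q → x ∈ q → p - x ≡ q - x → p ⊆ q
  incl p q x∈q eq {i} i∈p with i ≟ᶠ x
  ... | yes refl = x∈q
  ... | no  i≢x  = p─q⊆p q _ (subst (i ∈_) eq (x∈p∧x≢y⇒x∈p-y i∈p i≢x))

⁅⁆-injective : ∀ {x y : Fin n} → ⁅ x ⁆ ≡ ⁅ y ⁆ → x ≡ y
⁅⁆-injective {x = x} {y} eq = x∈⁅y⁆⇒x≡y y (subst (x ∈_) eq (x∈⁅x⁆ x))

-- If nothing were left, every member of `p` would be `x`, making `p` the singleton `⁅ x ⁆`. This is
-- what keeps isolation from leaving an empty block behind.
remove-nonempty : ∀ {p : Subset n} x → Nonempty p → ∣ p ∣ ≢ 1 → Nonempty (p - x)
remove-nonempty {p = p} x (i , i∈p) ∣p∣≢1 with nonempty? (p - x)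
... | yes ne = ne
... | no  ¬ne = contradiction (trans (cong ∣_∣ p≡⁅x⁆) (∣⁅x⁆∣≡1 x)) ∣p∣≢1
  where
  only-x : ∀ {j} → j ∈ p → j ≡ x
  only-x {j} j∈p with j ≟ᶠ x
  ... | yes j≡x = j≡x
  ... | no  j≢x = contradiction (j , x∈p∧x≢y⇒x∈p-y j∈p j≢x) ¬ne

  p≡⁅x⁆ : p ≡ ⁅ x ⁆
  p≡⁅x⁆ = ⊆-antisym
    (λ {j} j∈p → subst (_∈ ⁅ x ⁆) (sym (only-x j∈p)) (x∈⁅x⁆ x))
    (λ {j} j∈⁅x⁆ → subst (_∈ p) (trans (only-x i∈p) (sym (x∈⁅y⁆⇒x≡y x j∈⁅x⁆))) i∈p)

∈-subsets : (s : Subset n) → s ∈ˡ subsets n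
∈-subsets []            = here refl
∈-subsets (outside ∷ s) = ∈-++⁺ˡ (∈-map⁺ (outside ∷_) (∈-subsets s))
∈-subsets (inside  ∷ s) = ∈-++⁺ʳ (map (outside ∷_) (subsets _)) (∈-map⁺ (inside ∷_) (∈-subsets s))

subsets-unique : ∀ n → Unique (subsets n)
subsets-unique zero    = [] ∷ []
subsets-unique (suc n) = Unique.++⁺
  (Unique.map⁺ ∷-injectiveʳ (subsets-unique n))
  (Unique.map⁺ ∷-injectiveʳ (subsets-unique n))
  λ (s∈ , s∈′) → different (∈-map⁻ (outside ∷_) s∈) (∈-map⁻ (inside ∷_) s∈′)
  where
  different : ∀ {s} → (∃ λ t → t ∈ˡ subsets n × s ≡ outside ∷ t) →
                    ¬ (∃ λ t → t ∈ˡ subsets n × s ≡ inside ∷ t)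
  different (_ , _ , refl) (_ , _ , ())

-- Set partitions

-- The canonical representative of a set of blocks: members come in the order of `subsets n` and
-- without repetition, as `partitions n` demands.
normalise : List (Subset n) → List (Subset n)
normalise {n} xs = filter (λ s → member? _≟ˢ_ s xs) (subsets n)

module _ {xs : List (Subset n)} where

  ∈-normalise⁺ : xs ⊆ˡ normalise xs
  ∈-normalise⁺ s∈xs = ∈-filter⁺ (λ s → member? _≟ˢ_ s xs) (∈-subsets _) s∈xs

  ∈-normalise⁻ : normalise xs ⊆ˡ xs
  ∈-normalise⁻ s∈ = proj₂ (∈-filter⁻ (λ s → member? _≟ˢ_ s xs) {xs = subsets n} s∈)

  normalise-unique : Unique (normalise xs)
  normalise-unique = Unique.filter⁺ (λ s → member? _≟ˢ_ s xs) (subsets-unique n)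

  -- Disjointness is asked for in the form that blocks with a common element are equal. This is
  -- insensitive to order and repetition in `xs`; the uniqueness of the normal form turns it back
  -- into pairwise disjointness.
  normalise∈partitions :
    (∀ {s} → s ∈ˡ xs → Nonempty s) →
    (∀ {s t i} → s ∈ˡ xs → t ∈ˡ xs → i ∈ s → i ∈ t → s ≡ t) →
    (∀ i → ∃ λ s → s ∈ˡ xs × i ∈ s) →
    normalise xs ∈ˡ partitions n
  normalise∈partitions ne same cover = ∈-filter⁺ isPartition?
    (filter∈sublists (λ s → member? _≟ˢ_ s xs) (subsets n))
    (record
      { nonempty = All.tabulate (ne ∘ ∈-normalise⁻)
      ; disjoint = Unique⇒AllPairs normalise-unique λ {s} {t} s∈ t∈ s≢t (i , i∈s∩t) →
          let i∈s , i∈t = x∈p∩q⁻ s t i∈s∩t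
          in s≢t (same (∈-normalise⁻ s∈) (∈-normalise⁻ t∈) i∈s i∈t)
      ; covering = λ i → let s , s∈xs , i∈s = cover i in lose (∈-normalise⁺ s∈xs) i∈s
      })

partitions-unique : ∀ n → Unique (partitions n)
partitions-unique n = Unique.filter⁺ isPartition? (sublists-unique (subsets-unique n))

∈-partitions⇒IsPartition : {π : List (Subset n)} → π ∈ˡ partitions n → IsPartition π
∈-partitions⇒IsPartition {n} π∈ = proj₂ (∈-filter⁻ isPartition? {xs = sublists (subsets n)} π∈)

partitions-antisym : {π ρ : List (Subset n)} → π ∈ˡ partitions n → ρ ∈ˡ partitions n →
  π ⊆ˡ ρ → ρ ⊆ˡ π → π ≡ ρ
partitions-antisym {n} π∈ ρ∈ = sublists-antisym (subsets-unique n) (∈-sub π∈) (∈-sub ρ∈)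
  where
  ∈-sub : ∀ {π} → π ∈ˡ partitions n → π ∈ˡ sublists (subsets n)
  ∈-sub π∈ = proj₁ (∈-filter⁻ isPartition? {xs = sublists (subsets n)} π∈)

∈-partitions⇒Unique : {π : List (Subset n)} → π ∈ˡ partitions n → Unique π
∈-partitions⇒Unique {n} π∈ = distinct nonempty disjoint
  where
  open IsPartition (∈-partitions⇒IsPartition π∈)

  distinct : ∀ {xs : List (Subset n)} → All Nonempty xs → AllPairs (λ p q → Empty (p ∩ q)) xs → Unique xs
  distinct []                []         = []
  distinct ((i , i∈p) ∷ nes) (dj ∷ djs) =
    All.map (λ {dis refl → dis (i , x∈p∩q⁺ (i∈p , i∈p))}) dj ∷ distinct nes djs

AllDisjoint⇒same-block : {xs : List (Subset n)} → AllPairs (λ p q → Empty (p ∩ q)) xs →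
  ∀ {s t i} → s ∈ˡ xs → t ∈ˡ xs → i ∈ s → i ∈ t → s ≡ t
AllDisjoint⇒same-block (_  ∷ _)   (here refl) (here refl) _   _   = refl
AllDisjoint⇒same-block (dj ∷ _)   (here refl) (there t∈)  i∈s i∈t = contradiction (_ , x∈p∩q⁺ (i∈s , i∈t)) (All.lookup dj t∈)
AllDisjoint⇒same-block (dj ∷ _)   (there s∈)  (here refl) i∈s i∈t = contradiction (_ , x∈p∩q⁺ (i∈t , i∈s)) (All.lookup dj s∈)
AllDisjoint⇒same-block (_  ∷ djs) (there s∈)  (there t∈)  i∈s i∈t = AllDisjoint⇒same-block djs s∈ t∈ i∈s i∈t

blockOf : Fin n → List (Subset n) → Subset n
-- A default value, never reached when some block contains `i`.
blockOf i []       = ⊥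
blockOf i (p ∷ ps) = if does (i ∈? p) then p else blockOf i ps

blockOf-∈ : ∀ {i} {ps : List (Subset n)} → Any (i ∈_) ps → blockOf i ps ∈ˡ ps × i ∈ blockOf i ps
blockOf-∈ {i = i} {p ∷ ps} i∈ with i ∈? p | i∈
... | yes i∈p | _         = here refl , i∈p
... | no  i∉p | here i∈p  = contradiction i∈p i∉p
... | no  i∉p | there i∈ps = let b∈ , i∈b = blockOf-∈ i∈ps in there b∈ , i∈b

singletonFree : ∀ n → List (List (Subset n))
singletonFree n = filter (¬? ∘ hasSingleton?) (partitions n)

withSingleton : ∀ n → List (List (Subset n))
withSingleton n = filter hasSingleton? (partitions n)

record SingletonFreePartition (π : List (Subset n)) : Set where
  field
    listed      : π ∈ˡ partitions n
    noSingleton : ∀ {s} → s ∈ˡ π → ∣ s ∣ ≢ 1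

  open IsPartition (∈-partitions⇒IsPartition listed) public

  block-nonempty : ∀ {s} → s ∈ˡ π → Nonempty s
  block-nonempty = All.lookup nonempty

  same-block : ∀ {s t i} → s ∈ˡ π → t ∈ˡ π → i ∈ s → i ∈ t → s ≡ t
  same-block = AllDisjoint⇒same-block disjoint

  ⁅x⁆∉π : ∀ {x} → ⁅ x ⁆ ∉ˡ π
  ⁅x⁆∉π {x} ⁅x⁆∈π = noSingleton ⁅x⁆∈π (∣⁅x⁆∣≡1 x)

∈-singletonFree⁻ : {π : List (Subset n)} → π ∈ˡ singletonFree n → SingletonFreePartition π
∈-singletonFree⁻ {n} π∈ =
  let π∈ps , ¬single = ∈-filter⁻ (¬? ∘ hasSingleton?) {xs = partitions n} π∈ in record
  { listed = π∈ps ; noSingleton = λ s∈π ∣s∣≡1 → ¬single (lose s∈π ∣s∣≡1) }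

∈-withSingleton⁺ : ∀ {π : List (Subset n)} {x} → π ∈ˡ partitions n → ⁅ x ⁆ ∈ˡ π → π ∈ˡ withSingleton n
∈-withSingleton⁺ {x = x} π∈ ⁅x⁆∈π = ∈-filter⁺ hasSingleton? π∈ (lose ⁅x⁆∈π (∣⁅x⁆∣≡1 x))

-- Dissolving a block into singletons

dissolved : Subset n → List (Subset n) → List (Subset n)
dissolved {n} b π = filter (λ s → ¬? (s ≟ˢ b)) π ++ map ⁅_⁆ (filter (_∈? b) (allFin n))

dissolve : List (Subset n) → Subset n → List (Subset n)
dissolve π b = normalise (dissolved b π)

-- The two possible origins of a block after dissolving `b`, so that proofs argue by origin instead
-- of by position in a concatenation.
data DissolvedBlock (π : List (Subset n)) (b : Subset n) : Subset n → Set where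
  kept      : ∀ {s} → s ∈ˡ π → s ≢ b → DissolvedBlock π b s
  singleton : ∀ {x} → x ∈ b → DissolvedBlock π b ⁅ x ⁆

module _ {π : List (Subset n)} {b : Subset n} where

  ∈-dissolved⁺ : ∀ {s} → DissolvedBlock π b s → s ∈ˡ dissolved b π
  ∈-dissolved⁺ (kept s∈π s≢b)    = ∈-++⁺ˡ (∈-filter⁺ (λ s → ¬? (s ≟ˢ b)) s∈π s≢b)
  ∈-dissolved⁺ (singleton {x} x∈b) =
    ∈-++⁺ʳ (filter (λ s → ¬? (s ≟ˢ b)) π) (∈-map∘filter⁺ ⁅_⁆ (_∈? b) (x , ∈-allFin x , refl , x∈b))

  ∈-dissolved⁻ : ∀ {s} → s ∈ˡ dissolved b π → DissolvedBlock π b s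
  ∈-dissolved⁻ s∈ with ∈-++⁻ (filter (λ s → ¬? (s ≟ˢ b)) π) s∈
  ... | inj₁ s∈′ = let s∈π , s≢b = ∈-filter⁻ (λ s → ¬? (s ≟ˢ b)) {xs = π} s∈′ in kept s∈π s≢b
  ... | inj₂ s∈′ with x , _ , refl , x∈b ← ∈-map∘filter⁻ ⁅_⁆ (_∈? b) {xs = allFin n} s∈′ = singleton x∈b

  module _ (sf : SingletonFreePartition π) (b∈π : b ∈ˡ π) where
    open SingletonFreePartition sf

    dissolve∈partitions : dissolve π b ∈ˡ partitions n
    dissolve∈partitions = normalise∈partitions (ne ∘ ∈-dissolved⁻)
      (λ s∈ t∈ → same (∈-dissolved⁻ s∈) (∈-dissolved⁻ t∈))
      (λ i → let s , d , i∈s = cover i in s , ∈-dissolved⁺ d , i∈s)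
      where
      ne : ∀ {s} → DissolvedBlock π b s → Nonempty s
      ne (kept s∈π _)      = block-nonempty s∈π
      ne (singleton {x} _) = x , x∈⁅x⁆ x

      same : ∀ {s t i} → DissolvedBlock π b s → DissolvedBlock π b t → i ∈ s → i ∈ t → s ≡ t
      same (kept s∈π _)    (kept t∈π _)    i∈s i∈t = same-block s∈π t∈π i∈s i∈t
      -- A kept block that meets a new singleton contains an element of `b`, hence would be `b`
      -- itself.
      same (kept s∈π s≢b)  (singleton x∈b) i∈s i∈t with refl ← x∈⁅y⁆⇒x≡y _ i∈t =
        contradiction (same-block s∈π b∈π i∈s x∈b) s≢b
      same (singleton x∈b) (kept t∈π t≢b)  i∈s i∈t with refl ← x∈⁅y⁆⇒x≡y _ i∈s =
        contradiction (same-block t∈π b∈π i∈t x∈b) t≢b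
      same (singleton _)   (singleton _)   i∈s i∈t =
        cong ⁅_⁆ (trans (sym (x∈⁅y⁆⇒x≡y _ i∈s)) (x∈⁅y⁆⇒x≡y _ i∈t))

      cover : ∀ i → ∃ λ s → DissolvedBlock π b s × i ∈ s
      cover i with s , s∈π , i∈s ← find (covering i) with s ≟ˢ b
      ... | yes refl = ⁅ i ⁆ , singleton i∈s , x∈⁅x⁆ i
      ... | no  s≢b  = s , kept s∈π s≢b , i∈s

    dissolve∈withSingleton : dissolve π b ∈ˡ withSingleton n
    dissolve∈withSingleton = let x , x∈b = block-nonempty b∈π in
      ∈-withSingleton⁺ dissolve∈partitions (∈-normalise⁺ (∈-dissolved⁺ (singleton x∈b)))

∈-dissolve-≡ : ∀ (π ρ : List (Subset n)) {b c} → dissolve π b ≡ dissolve ρ c →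
  ∀ {s} → DissolvedBlock π b s → DissolvedBlock ρ c s
∈-dissolve-≡ π ρ eq = ∈-dissolved⁻ ∘ ∈-normalise⁻ ∘ subst (_ ∈ˡ_) eq ∘ ∈-normalise⁺ ∘ ∈-dissolved⁺

-- Kept blocks are never singletons, so the elements of `b` are exactly those `x` for which `⁅ x ⁆`
-- is a block of the result.
dissolve-injectiveʳ : {π ρ : List (Subset n)} {b c : Subset n} →
  SingletonFreePartition π → SingletonFreePartition ρ → dissolve π b ≡ dissolve ρ c → b ≡ c
dissolve-injectiveʳ {π = π} {ρ} sfπ sfρ eq = ⊆-antisym (incl π ρ sfρ eq) (incl ρ π sfπ (sym eq))
  where
  singleton⁻ : ∀ {ρ} {c : Subset _} → SingletonFreePartition ρ →
    ∀ {s x} → DissolvedBlock ρ c s → s ≡ ⁅ x ⁆ → x ∈ c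
  singleton⁻ sf (kept s∈ρ _)    refl = contradiction s∈ρ (SingletonFreePartition.⁅x⁆∉π sf)
  singleton⁻ sf (singleton y∈c) eq   = subst (_∈ _) (⁅⁆-injective eq) y∈c

  incl : ∀ π ρ {b c : Subset _} → SingletonFreePartition ρ → dissolve π b ≡ dissolve ρ c → b ⊆ c
  incl π ρ sf eq x∈b = singleton⁻ sf (∈-dissolve-≡ π ρ eq (singleton x∈b)) refl

-- The dissolved blocks agree by the previous lemma. Any other block of `π` survives in the common
-- result, and there it cannot be one of the new singletons because `π` has none; so it was kept
-- from `ρ`.
dissolve-injectiveˡ : {π ρ : List (Subset n)} {b c : Subset n} →
  SingletonFreePartition π → SingletonFreePartition ρ → b ∈ˡ π → c ∈ˡ ρ →
  dissolve π b ≡ dissolve ρ c → π ≡ ρ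
dissolve-injectiveˡ {π = π} {ρ} {b} sfπ sfρ b∈π c∈ρ eq with refl ← dissolve-injectiveʳ sfπ sfρ eq =
  partitions-antisym (listed sfπ) (listed sfρ) (incl π ρ sfπ c∈ρ eq) (incl ρ π sfρ b∈π (sym eq))
  where
  open SingletonFreePartition using (listed; ⁅x⁆∉π)

  incl : ∀ π ρ → SingletonFreePartition π → b ∈ˡ ρ → dissolve π b ≡ dissolve ρ b → π ⊆ˡ ρ
  incl π ρ sf b∈ρ eq {s} s∈π with s ≟ˢ b
  ... | yes refl = b∈ρ
  ... | no  s≢b with ∈-dissolve-≡ π ρ eq (kept s∈π s≢b)
  ...   | kept s∈ρ _  = s∈ρ
  ...   | singleton _ = contradiction s∈π (⁅x⁆∉π sf)

manyBlocks : ∀ n k → List (List (Subset n))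
manyBlocks n k = filter (λ π → ¬? (length π <? k)) (singletonFree n)

-- Dissolving each block in turn gives at least `k` different results per partition, and no result
-- arises from two partitions. All results lie in `withSingleton n`, which is no longer than
-- `partitions n`.
manyBlocks-bound : ∀ n k → length (manyBlocks n k) * k ≤ #partitions n
manyBlocks-bound n k = ≤-trans
  (disjoint-images⇒length-≤ (λ π → map (dissolve π) π)
    (Unique.filter⁺ _ (Unique.filter⁺ _ (partitions-unique n)))
    (λ π∈ → let sf = free π∈ in
      Unique-map _ (∈-partitions⇒Unique (listed sf)) λ _ _ → dissolve-injectiveʳ sf sf)
    (λ {π} {ρ} π∈ ρ∈ σ∈ σ∈′ →
      let b , b∈π , eq = ∈-map⁻ (dissolve π) σ∈ ; c , c∈ρ , eq′ = ∈-map⁻ (dissolve ρ) σ∈′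
      in dissolve-injectiveˡ (free π∈) (free ρ∈) b∈π c∈ρ (trans (sym eq) eq′))
    (λ {π} π∈ σ∈ → let b , b∈π , eq = ∈-map⁻ (dissolve π) σ∈ in
      subst (_∈ˡ withSingleton n) (sym eq) (dissolve∈withSingleton (free π∈) b∈π))
    (λ {π} π∈ → ≤-trans
      (≮⇒≥ (proj₂ (∈-filter⁻ (λ π → ¬? (length π <? k)) {xs = singletonFree n} π∈)))
      (≤-reflexive (sym (length-map (dissolve π) π)))))
  (length-filter hasSingleton? (partitions n))
  where
  open SingletonFreePartition using (listed)

  free : ∀ {π} → π ∈ˡ manyBlocks n k → SingletonFreePartition π
  free π∈ = ∈-singletonFree⁻ (proj₁ (∈-filter⁻ (λ π → ¬? (length π <? k)) {xs = singletonFree n} π∈))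

-- Isolating an element

-- Removing `x` from every block changes only the one that contains it, so that block need not be
-- singled out in the definition.
isolate : List (Subset n) → Fin n → List (Subset n)
isolate π x = normalise (⁅ x ⁆ ∷ map (_- x) π)

length-isolate : (π : List (Subset n)) (x : Fin n) → length (isolate π x) ≤ suc (length π)
length-isolate π x = ≤-trans
  (Unique-⊆⇒length-≤ (normalise-unique {xs = ⁅ x ⁆ ∷ map (_- x) π}) ∈-normalise⁻)
  (≤-reflexive (cong suc (length-map (_- x) π)))

module _ {π : List (Subset n)} (sf : SingletonFreePartition π) (x : Fin n) where
  open SingletonFreePartition sf

  isolate∈partitions : isolate π x ∈ˡ partitions n
  isolate∈partitions = normalise∈partitions ne same cover
    where
    ne : ∀ {s} → s ∈ˡ ⁅ x ⁆ ∷ map (_- x) π → Nonempty s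
    ne (here refl) = x , x∈⁅x⁆ x
    ne (there s∈) with t , t∈π , refl ← ∈-map⁻ (_- x) s∈ =
      remove-nonempty x (block-nonempty t∈π) (noSingleton t∈π)

    x∉ : ∀ {s i} → s ∈ˡ map (_- x) π → i ∈ s → i ∉ ⁅ x ⁆
    x∉ s∈ i∈s i∈⁅x⁆ with t , _ , refl ← ∈-map⁻ (_- x) s∈ | refl ← x∈⁅y⁆⇒x≡y x i∈⁅x⁆ = x∉p-x t i∈s

    same : ∀ {s t i} → s ∈ˡ ⁅ x ⁆ ∷ map (_- x) π → t ∈ˡ ⁅ x ⁆ ∷ map (_- x) π → i ∈ s → i ∈ t → s ≡ t
    same (here refl) (here refl) _   _   = refl
    same (here refl) (there t∈)  i∈s i∈t = contradiction i∈s (x∉ t∈ i∈t)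
    same (there s∈)  (here refl) i∈s i∈t = contradiction i∈t (x∉ s∈ i∈s)
    same (there s∈)  (there t∈)  i∈s i∈t
      with s′ , s′∈π , refl ← ∈-map⁻ (_- x) s∈ | t′ , t′∈π , refl ← ∈-map⁻ (_- x) t∈ =
      cong (_- x) (same-block s′∈π t′∈π (p─q⊆p s′ _ i∈s) (p─q⊆p t′ _ i∈t))

    cover : ∀ i → ∃ λ s → s ∈ˡ ⁅ x ⁆ ∷ map (_- x) π × i ∈ s
    cover i with i ≟ᶠ x
    ... | yes refl = ⁅ x ⁆ , here refl , x∈⁅x⁆ x
    ... | no  i≢x  = let s , s∈π , i∈s = find (covering i) in
      s - x , there (∈-map⁺ (_- x) s∈π) , x∈p∧x≢y⇒x∈p-y i∈s i≢x

  blockOf∈π : blockOf x π ∈ˡ π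
  blockOf∈π = proj₁ (blockOf-∈ (covering x))

  x∈blockOf : x ∈ blockOf x π
  x∈blockOf = proj₂ (blockOf-∈ (covering x))

  blockOf-unique : ∀ {s} → s ∈ˡ π → x ∈ s → s ≡ blockOf x π
  blockOf-unique s∈π x∈s = same-block s∈π blockOf∈π x∈s x∈blockOf

-- The marks make isolation reversible. The first tells `x` apart from the other singleton that
-- appears when the block of `x` had two elements; the second tells which block `x` returns to.
markedIsolate : List (Subset n) → Fin n → List (Subset n) × Subset n × Subset n
markedIsolate π x = isolate π x , ⁅ x ⁆ , blockOf x π - x

markedIsolate-injectiveʳ : ∀ (π ρ : List (Subset n)) {x y} → markedIsolate π x ≡ markedIsolate ρ y → x ≡ y
markedIsolate-injectiveʳ π ρ eq = ⁅⁆-injective (cong (proj₁ ∘ proj₂) eq)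

-- The first mark yields `x`, and putting `x` back into the second yields its block, which is
-- therefore common to `π` and `ρ`. Blocks avoiding `x` pass through isolation unchanged.
markedIsolate-injectiveˡ : {π ρ : List (Subset n)} {x y : Fin n} →
  SingletonFreePartition π → SingletonFreePartition ρ →
  markedIsolate π x ≡ markedIsolate ρ y → π ≡ ρ
markedIsolate-injectiveˡ {n} {π} {ρ} {x} sfπ sfρ eq with refl ← markedIsolate-injectiveʳ π ρ eq =
  partitions-antisym (listed sfπ) (listed sfρ)
    (incl sfπ sfρ (cong proj₁ eq) blockOf-≡)
    (incl sfρ sfπ (cong proj₁ (sym eq)) (sym blockOf-≡))
  where
  open SingletonFreePartition using (listed; same-block; block-nonempty; noSingleton)

  blockOf-≡ : blockOf x π ≡ blockOf x ρ
  blockOf-≡ = remove-injective (x∈blockOf sfπ x) (x∈blockOf sfρ x) (cong (proj₂ ∘ proj₂) eq)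

  incl : ∀ {π ρ} → SingletonFreePartition π → SingletonFreePartition ρ →
    isolate π x ≡ isolate ρ x → blockOf x π ≡ blockOf x ρ → π ⊆ˡ ρ
  incl {π} {ρ} sfπ sfρ σ≡ b≡ {t} t∈π with x ∈? t
  ... | yes x∈t = subst (_∈ˡ ρ) (sym (trans (blockOf-unique sfπ x t∈π x∈t) b≡)) (blockOf∈π sfρ x)
  -- Here `t - x` is `t`; as a block of the isolation of `ρ` it is either `⁅ x ⁆` or some `u - x`
  -- with `u` in `ρ`.
  ... | no  x∉t with ∈-normalise⁻ (subst (t - x ∈ˡ_) σ≡ (∈-normalise⁺ (there (∈-map⁺ (_- x) t∈π))))
  ...   | here t-x≡⁅x⁆ = contradiction (subst (x ∈_) (sym t-x≡⁅x⁆) (x∈⁅x⁆ x)) (x∉p-x t)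
  ...   | there t-x∈ with u , u∈ρ , t-x≡u-x ← ∈-map⁻ (_- x) t-x∈ with x ∈? u
  ...     | no  x∉u = subst (_∈ˡ ρ) (trans (sym (x∉p⇒p-x≡p x∉u)) (trans (sym t-x≡u-x) (x∉p⇒p-x≡p x∉t))) u∈ρ
  -- Now `u` is the common block of `x`. The nonempty set `t - x` equals `u - x`, so `t` meets that
  -- block inside `π` and coincides with it, although `t` avoids `x`.
  ...     | yes x∈u = contradiction (subst (x ∈_) (sym t≡b) (x∈blockOf sfπ x)) x∉t
    where
    u≡b : u ≡ blockOf x π
    u≡b = trans (blockOf-unique sfρ x u∈ρ x∈u) (sym b≡)

    t≡b : t ≡ blockOf x π
    t≡b = let i , i∈t-x = remove-nonempty x (block-nonempty sfπ t∈π) (noSingleton sfπ t∈π) in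
      same-block sfπ t∈π (blockOf∈π sfπ x) (p─q⊆p t _ i∈t-x)
        (subst (i ∈_) u≡b (p─q⊆p u _ (subst (i ∈_) t-x≡u-x i∈t-x)))

fewBlocks : ∀ n k → List (List (Subset n))
fewBlocks n k = filter (λ π → length π <? k) (singletonFree n)

-- Each `π` gives `n` marked results, one for each element. A result is a partition with at most `k`
-- blocks together with an ordered pair of its blocks, which leaves at most `k * k` choices of
-- marks.
fewBlocks-bound : ∀ n k → length (fewBlocks n k) * n ≤ #partitions n * (k * k)
fewBlocks-bound n k = ≤-trans
  (disjoint-images⇒length-≤ (λ π → map (markedIsolate π) (allFin n))
    (Unique.filter⁺ _ (Unique.filter⁺ _ (partitions-unique n)))
    (λ {π} _ → Unique-map _ (Unique.allFin⁺ n) λ _ _ → markedIsolate-injectiveʳ π π)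
    (λ {π} {ρ} π∈ ρ∈ τ∈ τ∈′ →
      let _ , _ , eq = ∈-map⁻ (markedIsolate π) τ∈ ; _ , _ , eq′ = ∈-map⁻ (markedIsolate ρ) τ∈′
      in markedIsolate-injectiveˡ (free π∈) (free ρ∈) (trans (sym eq) eq′))
    (λ {π} π∈ τ∈ → let x , _ , eq = ∈-map⁻ (markedIsolate π) τ∈ in
      subst (_∈ˡ marked) (sym eq) (markedIsolate∈ π∈ x))
    (λ {π} _ → ≤-reflexive
      (sym (trans (length-map (markedIsolate π) (allFin n)) (length-tabulate {n = n} (λ i → i))))))
  (≤-trans
    (length-concatMap-≤ marks small λ {σ} σ∈ →
      let σ≤k = proj₂ (∈-filter⁻ (λ σ → length σ ≤? k) {xs = partitions n} σ∈) in
      ≤-trans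
        (≤-reflexive (trans (length-map (σ ,_) (cartesianProduct σ σ)) (length-cartesianProduct σ σ)))
        (*-mono-≤ σ≤k σ≤k))
    (*-monoˡ-≤ (k * k) (length-filter (λ σ → length σ ≤? k) (partitions n))))
  where
  small : List (List (Subset n))
  small = filter (λ σ → length σ ≤? k) (partitions n)

  marks : List (Subset n) → List (List (Subset n) × Subset n × Subset n)
  marks σ = map (σ ,_) (cartesianProduct σ σ)

  marked : List (List (Subset n) × Subset n × Subset n)
  marked = concatMap marks small

  free : ∀ {π} → π ∈ˡ fewBlocks n k → SingletonFreePartition π
  free π∈ = ∈-singletonFree⁻ (proj₁ (∈-filter⁻ (λ π → length π <? k) {xs = singletonFree n} π∈))

  markedIsolate∈ : ∀ {π} → π ∈ˡ fewBlocks n k → ∀ x → markedIsolate π x ∈ˡ marked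
  markedIsolate∈ {π} π∈ x = ∈-concatMap⁺ marks (lose
    (∈-filter⁺ (λ σ → length σ ≤? k) (isolate∈partitions sf x)
      -- `length π < k` unfolds to `suc (length π) ≤ k`, which leaves room for the additional block
      -- `⁅ x ⁆`.
      (≤-trans (length-isolate π x)
        (proj₂ (∈-filter⁻ (λ π → length π <? k) {xs = singletonFree n} π∈))))
    (∈-map⁺ (isolate π x ,_) (∈-cartesianProduct⁺
      (∈-normalise⁺ (here refl))
      (∈-normalise⁺ (there (∈-map⁺ (_- x) (blockOf∈π sf x)))))))
    where sf = free π∈

-- Asymptotics

singletonFree-bound : ∀ n k .{{_ : NonZero k}} → k * (k * k) ≤ n →
  length (singletonFree n) * k ≤ #partitions n * 2
singletonFree-bound n k k³≤n = begin
  length (singletonFree n) * k  ≡⟨ cong (_* k) (length-filter-¬ (λ π → length π <? k) (singletonFree n)) ⟨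
  (f + g) * k                   ≡⟨ *-distribʳ-+ k f g ⟩
  f * k + g * k                 ≤⟨ +-mono-≤ fk≤total (manyBlocks-bound n k) ⟩
  total + total                         ≡⟨ double total ⟩
  total * 2                         ∎
  where
  open ≤-Reasoning
  f = length (fewBlocks n k)
  g = length (manyBlocks n k)
  total = #partitions n

  double : ∀ m → m + m ≡ m * 2
  double = solve-∀

  fk≤total : f * k ≤ total
  -- The cubic threshold pays for both the factor `k` wanted here and the factor `k * k` lost to the
  -- marks.
  fk≤total = *-cancelʳ-≤ (f * k) total (k * k) {{m*n≢0 k k}} (begin
    f * k * (k * k)    ≡⟨ *-assoc f k (k * k) ⟩
    f * (k * (k * k))  ≤⟨ *-monoʳ-≤ f k³≤n ⟩
    f * n              ≤⟨ fewBlocks-bound n k ⟩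
    total * (k * k)        ∎)

-- Taking `k = 3 * q` bounds the proportion without singletons by 2/(3q). The factor 3 exceeds the 2
-- of the previous bound, and since there is at least one partition the inequality becomes strict.
singletonFree-rare : ∀ n q .{{_ : NonZero q}} → (3 * q) * ((3 * q) * (3 * q)) ≤ n →
  length (singletonFree n) * q < #partitions n
singletonFree-rare n q ≤n = *-cancelʳ-< 3 (s * q) total (begin-strict
  s * q * 3    ≡⟨ rearrange s q ⟩
  s * (3 * q)  ≤⟨ singletonFree-bound n (3 * q) {{m*n≢0 3 q}} ≤n ⟩
  total * 2        <⟨ *-monoʳ-< total {{#partitions-nonZero n}} (n<1+n 2) ⟩
  total * 3        ∎)
  where
  open ≤-Reasoning
  s = length (singletonFree n)
  total = #partitions n

  rearrange : ∀ s q → s * q * 3 ≡ s * (3 * q)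
  rearrange = solve-∀

-- The distance is `s` over `b`. A positive rational is at least the reciprocal of its denominator,
-- so it suffices to beat that reciprocal.
∣w/b-1∣<ε : ∀ w s b .{{_ : NonZero b}} ε → w + s ≡ b → 0ℚ <ℚ ε → s * ↧ₙ ε < b →
  ∣ ℤ.+ w / b -ℚ 1ℚ ∣ℚ <ℚ ε
∣w/b-1∣<ε w s b@(suc b-1) ε@(mkℚ (ℤ.+ zero) d _) _ (*<* (+<+ ())) _
∣w/b-1∣<ε w s b@(suc b-1) ε@(mkℚ +[1+ p ] d _) w+s≡b _ sd<b = ℚ.toℚᵘ-cancel-<
  (ℚᵘ.<-respˡ-≃ (ℚᵘ.≃-sym toℚᵘ-≃) (ℚᵘ.*<* (subst₂ ℤ._<_ (ℤ.pos-* s (suc d)) (ℤ.pos-* (suc p) b)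
    -- The numerator `suc p` of `ε` is at least 1, so multiplying `b` by it preserves the bound.
    (+<+ (≤-trans sd<b (m≤n*m b (suc p)))))))
  where
  -- The left side has the shape of the numerator that unnormalised addition produces for `w` over
  -- `b` plus -1.
  ℤ-cancel : ∀ i j → i ℤ.* ℤ.1ℤ ℤ.+ ℤ.-1ℤ ℤ.* (i ℤ.+ j) ≡ ℤ.- j
  ℤ-cancel = ℤ-solve-∀

  ∣w-b∣≡s : ℤ.∣ ℤ.+ w ℤ.* ℤ.1ℤ ℤ.+ ℤ.-1ℤ ℤ.* ℤ.+ b ∣ ≡ s
  ∣w-b∣≡s = trans
    (cong ℤ.∣_∣ (trans (cong (λ c → ℤ.+ w ℤ.* ℤ.1ℤ ℤ.+ ℤ.-1ℤ ℤ.* ℤ.+ c) (sym w+s≡b))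
                       (ℤ-cancel (ℤ.+ w) (ℤ.+ s))))
    (ℤ.∣-i∣≡∣i∣ (ℤ.+ s))

  -- `_/_` reduces to lowest terms, which hides `w` and `b`; among unnormalised rationals the
  -- denominator `b` stays visible.
  toℚᵘ-≃ : toℚᵘ ∣ ℤ.+ w / b -ℚ 1ℚ ∣ℚ ≃ mkℚᵘ (ℤ.+ s) b-1
  toℚᵘ-≃ = begin
    toℚᵘ ∣ ℤ.+ w / b -ℚ 1ℚ ∣ℚ                 ≈⟨ ℚ.toℚᵘ-homo-∣-∣ (ℤ.+ w / b -ℚ 1ℚ) ⟩
    ℚᵘ.∣ toℚᵘ (ℤ.+ w / b -ℚ 1ℚ) ∣             ≈⟨ ℚᵘ.∣-∣-cong (ℚ.toℚᵘ-homo-+ (ℤ.+ w / b) (-ℚ 1ℚ)) ⟩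
    ℚᵘ.∣ toℚᵘ (ℤ.+ w / b) ℚᵘ.+ toℚᵘ (-ℚ 1ℚ) ∣ ≈⟨ ℚᵘ.∣-∣-cong (ℚᵘ.+-congˡ (toℚᵘ (-ℚ 1ℚ)) (ℚ.toℚᵘ-fromℚᵘ (mkℚᵘ (ℤ.+ w) b-1))) ⟩
    ℚᵘ.∣ mkℚᵘ (ℤ.+ w) b-1 ℚᵘ.+ toℚᵘ (-ℚ 1ℚ) ∣ ≈⟨ ℚᵘ.*≡* (cong₂ (λ x y → ℤ.+ x ℤ.* ℤ.+ y) ∣w-b∣≡s (sym (*-identityʳ b))) ⟩
    mkℚᵘ (ℤ.+ s) b-1                          ∎
    where open ℚᵘ.≃-Reasoning

mainTheorem6 : proportionWithSingleton ⟶ 1ℚ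
mainTheorem6 ε 0<ε = K * (K * K) , λ n K³≤n →
  ∣w/b-1∣<ε (#partitionsWithSingleton n) (length (singletonFree n)) (#partitions n)
    {{#partitions-nonZero n}} ε (length-filter-¬ hasSingleton? (partitions n)) 0<ε
    (singletonFree-rare n (↧ₙ ε) K³≤n)
  where
  -- The block threshold `k` for this `ε`: `singletonFree-rare` is used with `q` the denominator of
  -- `ε`, and its cubic condition on `n` supplies the witness.
  K = 3 * ↧ₙ ε
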